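{- (i) For all positive integers $n,k$, $Z_{\mathsf{Chain}^3}(n;k) \le 9n(k-1)$. (ii) For every integer $k \ge 2$ there exist constants $c_k>0$ and $n_k$ such that for all $n \ge n_k$, $$Z_{\mathsf{Chain}^4}(n;k) \;\ge\; c_k\, n k \cdot \frac{\log n}{\log\log n}.$$
   Context: All graphs are finite and bipartite, written $G=(U\cup V,E)$ with a fixed bipartition. A bipartite graph is a chain graph (class $\mathsf{Chain}$) if one side of the bipartition can be mapped to rightward rays $[a,\infty)\subseteq\mathbb{R}$ and the other side to points of $\mathbb{R}$ so that two vertices are adjacent iff the point lies in the ray. For graph classes $\mathcal{C}_1,\mathcal{C}_2$, the class $\mathcal{C}_1\cdot\mathcal{C}_2$ consists of all graphs $G_1\cap G_2=(V(G_1)\cap V(G_2),E(G_1)\cap E(G_2))$ with $G_1\in\mathcal{C}_1$, $G_2\in\mathcal{C}_2$; $\mathcal{C}^d$ denotes $\mathcal{C}\cdot\mathcal{C}\cdots\mathcal{C}$ ($d$ times). The graphs in $\mathsf{Chain}^d$ are the bipartite graphs of Ferrers dimension at most $d$. For a class $\mathcal{C}$ of bipartite graphs, $Z_{\mathcal{C}}(n,m;k,k)$ is the maximum number of edges of a graph $G=(U\cup V,E)\in\mathcal{C}$ with $|U|=n$, $|V|=m$ that does not contain the complete bipartite graph $K_{k,k}$ as a subgraph, and $Z_{\mathcal{C}}(n;k)=Z_{\mathcal{C}}(n,n;k,k)$. -}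

module Defs where

open import Data.Nat using (ℕ; zero; suc; _+_; _*_; _≤_)
open import Data.Bool using (Bool; true; false; if_then_else_)
open import Data.Fin using (Fin)
import Data.Fin as F
open import Data.Rational using (ℚ)
import Data.Rational as Q
open import Data.Product using (Σ; ∃; ∃-syntax; _×_; _,_)
open import Data.Sum using (_⊎_)
open import Function.Bundles using (_⇔_)
open import Function.Definitions using (Injective)
open import Relation.Binary.PropositionalEquality using (_≡_)

BipGraph : ℕ → ℕ → Set
BipGraph n m = Fin n → Fin m → Bool

sumFin : (n : ℕ) → (Fin n → ℕ) → ℕ
sumFin zero    f = 0
sumFin (suc n) f = f F.zero + sumFin n (λ i → f (F.suc i))

edges : ∀ {n m} → BipGraph n m → ℕ
edges {n} {m} G = sumFin n (λ u → sumFin m (λ v → if G u v then 1 else 0))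

-- Chain graph: one side is mapped to rightward rays [a,∞), the other
-- side to points, adjacency iff the point lies in the ray.
-- Either U gets the rays (first case) or V gets the rays (second case).
IsChain : ∀ {n m} → BipGraph n m → Set
IsChain {n} {m} G =
  Σ (Fin n → ℚ) λ f → Σ (Fin m → ℚ) λ g →
    ( (∀ (u : Fin n) (v : Fin m) → (G u v ≡ true) ⇔ (f u Q.≤ g v))
    ⊎ (∀ (u : Fin n) (v : Fin m) → (G u v ≡ true) ⇔ (g v Q.≤ f u)) )

IsChainPow : (d : ℕ) → ∀ {n m} → BipGraph n m → Set
IsChainPow d {n} {m} G =
  Σ (Fin d → BipGraph n m) λ Gs →
    (∀ i → IsChain (Gs i)) ×
    (∀ (u : Fin n) (v : Fin m) → (G u v ≡ true) ⇔ (∀ i → Gs i u v ≡ true))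

ContainsK : (k : ℕ) → ∀ {n m} → BipGraph n m → Set
ContainsK k {n} {m} G =
  Σ (Fin k → Fin n) λ a → Σ (Fin k → Fin m) λ b →
    Injective _≡_ _≡_ a × Injective _≡_ _≡_ b ×
    (∀ i j → G (a i) (b j) ≡ true)

{-# OPTIONS --safe #-}
-- (i) Choose coordinates such that u and v are adjacent iff f i u ≤ g i v for
-- the three indices i, and put t = k − 1.  For each u and each coordinate l,
-- discard the edges to the t neighbours of u that are largest in coordinate l;
-- this costs at most 3nt edges.  If u v survives, then for every l the vertex v
-- has at most t neighbours w lying below u in both coordinates other than l:
-- otherwise these w, with the k neighbours of u that are at least v in
-- coordinate l, span a K_{k,k}.  Of any two points in three dimensions one lies
-- below the other in two coordinates, so the surviving neighbours of v form a
-- tournament with in-degrees at most 3t, and there are at most 6t of them.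
--
-- (ii) As the constant may depend on k, the case k = 2 is enough.  Take c · b^ℓ
-- points, indexed by words of ℓ digits in base b followed by a symbol below c,
-- ordered lexicographically in x and reverse lexicographically in y.  Fixing all
-- digits but one defines a box with b points; every point lies in ℓ boxes, and
-- two points in a common box differ in one digit only, which determines the box.
-- If ℓ ≤ b there are no more boxes than points.
module Submission where

open import Defs
open import Algebra.Properties.Group using (⁻¹-involutive)
open import Data.Bool using (true; if_then_else_)
import Data.Bool as Bool
open import Data.Fin using (Fin; zero; suc; toℕ; splitAt; _↑ˡ_)
open import Data.Fin.Properties using (all?; any?; toℕ<n; toℕ≤pred[n]; toℕ-injective; suc-injective; splitAt-↑ˡ; splitAt⁻¹-↑ˡ; +↔⊎; *↔×)
import Data.Fin as Fin
import Data.Integer as ℤ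
import Data.Integer.Properties as ℤ
open import Data.Maybe using (Maybe; just; nothing)
open import Data.Nat using (ℕ; zero; suc; pred; _+_; _*_; _∸_; _^_; _≤_; _<_; z≤n; s≤s; s<s; _≤?_; _<?_; NonZero; ⌊_/2⌋; ⌈_/2⌉; >-nonZero)
open import Data.Nat.Coprimality using (1-coprimeTo)
import Data.Nat.Coprimality as Coprimality
open import Data.Nat.DivMod using (_/_; _%_; m≡m%n+[m/n]*n; m%n<n; m/n≤m; m≥n⇒m/n>0)
open import Data.Nat.Logarithm using (⌊log₂_⌋; ⌊log₂⌋-mono-≤; ⌊log₂[2^n]⌋≡n; ⌊log₂⌊n/2⌋⌋≡⌊log₂n⌋∸1)
open import Data.Nat.Properties hiding (suc-injective)
open import Data.Nat.Solver using (module +-*-Solver)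
open import Data.Product using (Σ; ∃; ∃-syntax; _×_; _,_; proj₁; proj₂)
open import Data.Product.Function.NonDependent.Propositional using (_×-↔_)
open import Data.Rational using (ℚ; mkℚ; *≤*)
import Data.Rational as ℚ
import Data.Rational.Properties as ℚ
open import Data.Sum using (_⊎_; inj₁; inj₂; [_,_])
open import Data.Sum.Function.Propositional using (_⊎-↔_)
open import Data.Sum.Properties using (inj₁-injective)
open import Data.Maybe.Properties using (just-injective)
open import Function using (_∘_; const; _⇔_; _↔_; mk⇔; module Equivalence; module Inverse)
open import Function.Definitions using (Injective)
open import Function.Properties.Inverse using (↔-refl; ↔-trans; ↔-sym)
open import Relation.Binary.Definitions using () renaming (Decidable to Decidable₂)
open import Relation.Binary.PropositionalEquality using (_≡_; _≢_; refl; sym; trans; cong; cong₂; subst; subst₂)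
open import Relation.Nullary using (¬_; Dec; yes; no; does; contradiction; ¬?)
open import Relation.Nullary.Decidable using (_×-dec_; _→-dec_; dec-true)
open import Relation.Unary using (Decidable)

-- Finite sums and counting

sumFin-mono : ∀ n {f g : Fin n → ℕ} → (∀ i → f i ≤ g i) → sumFin n f ≤ sumFin n g
sumFin-mono zero    h = z≤n
sumFin-mono (suc n) h = +-mono-≤ (h zero) (sumFin-mono n (h ∘ suc))

sumFin-const : ∀ n c → sumFin n (const c) ≡ n * c
sumFin-const zero    c = refl
sumFin-const (suc n) c = cong (c +_) (sumFin-const n c)

sumFin-≤ : ∀ n {f : Fin n → ℕ} {c} → (∀ i → f i ≤ c) → sumFin n f ≤ n * c
sumFin-≤ n {c = c} h = ≤-trans (sumFin-mono n h) (≤-reflexive (sumFin-const n c))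

sumFin-+ : ∀ n (f g : Fin n → ℕ) → sumFin n (λ i → f i + g i) ≡ sumFin n f + sumFin n g
sumFin-+ zero    f g = refl
sumFin-+ (suc n) f g = trans (cong (f zero + g zero +_) (sumFin-+ n (f ∘ suc) (g ∘ suc)))
  (solve 4 (λ a b c d → (a :+ b) :+ (c :+ d) := (a :+ c) :+ (b :+ d)) refl
    (f zero) (g zero) (sumFin n (f ∘ suc)) (sumFin n (g ∘ suc)))
  where open +-*-Solver

sumFin-*ʳ : ∀ n (f : Fin n → ℕ) c → sumFin n (λ i → f i * c) ≡ sumFin n f * c
sumFin-*ʳ zero    f c = refl
sumFin-*ʳ (suc n) f c =
  trans (cong (f zero * c +_) (sumFin-*ʳ n (f ∘ suc) c)) (sym (*-distribʳ-+ c (f zero) _))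

sumFin-cong : ∀ n {f g : Fin n → ℕ} → (∀ i → f i ≡ g i) → sumFin n f ≡ sumFin n g
sumFin-cong zero    h = refl
sumFin-cong (suc n) h = cong₂ _+_ (h zero) (sumFin-cong n (h ∘ suc))

sumFin-swap : ∀ m n (f : Fin m → Fin n → ℕ) →
  sumFin m (λ i → sumFin n (f i)) ≡ sumFin n (λ j → sumFin m (λ i → f i j))
sumFin-swap zero    n f = sym (trans (sumFin-const n 0) (*-zeroʳ n))
sumFin-swap (suc m) n f = trans (cong (sumFin n (f zero) +_) (sumFin-swap m n (f ∘ suc)))
  (sym (sumFin-+ n (f zero) (λ j → sumFin m (λ i → f (suc i) j))))

term≤sumFin : ∀ n (f : Fin n → ℕ) i → f i ≤ sumFin n f
term≤sumFin (suc n) f zero    = m≤m+n _ _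
term≤sumFin (suc n) f (suc i) = ≤-trans (term≤sumFin n (f ∘ suc) i) (m≤n+m _ _)

private variable
  P Q : Set

ind : Dec P → ℕ
ind d = if does d then 1 else 0

ind-true : (d : Dec P) → P → ind d ≡ 1
ind-true d p = cong (if_then 1 else 0) (dec-true d p)

ind-mono : (d : Dec P) (e : Dec Q) → (P → Q) → ind d ≤ ind e
ind-mono (no _)  e h = z≤n
ind-mono (yes p) e h = ≤-reflexive (sym (ind-true e (h p)))

ind-≤ : (d : Dec P) {c : ℕ} → (P → 1 ≤ c) → ind d ≤ c
ind-≤ (no _)  h = z≤n
ind-≤ (yes p) h = h p

ind-⊎ : ∀ {R : Set} (d : Dec P) (e : Dec Q) (r : Dec R) → (P → Q ⊎ R) → ind d ≤ ind e + ind r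
ind-⊎ d e r h = ind-≤ d ([ (λ q → ≤-trans (≤-reflexive (sym (ind-true e q))) (m≤m+n _ _))
                         , (λ p → ≤-trans (≤-reflexive (sym (ind-true r p))) (m≤n+m _ _)) ] ∘ h)

ind-≟true : ∀ b → (if b then 1 else 0) ≡ ind (b Bool.≟ true)
ind-≟true Bool.true  = refl
ind-≟true Bool.false = refl

count : ∀ {n} {P : Fin n → Set} → Decidable P → ℕ
count {n} P? = sumFin n (λ i → ind (P? i))

count-mono : ∀ {n} {P Q : Fin n → Set} (P? : Decidable P) (Q? : Decidable Q) →
  (∀ i → P i → Q i) → count P? ≤ count Q?
count-mono P? Q? h = sumFin-mono _ (λ i → ind-mono (P? i) (Q? i) (h i))

count-empty : ∀ {n} {P : Fin n → Set} (P? : Decidable P) → (∀ i → ¬ P i) → count P? ≡ 0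
count-empty {n} P? h = n≤0⇒n≡0 (≤-trans
  (sumFin-≤ n (λ i → ind-≤ (P? i) {0} (λ p → contradiction p (h i))))
  (≤-reflexive (*-zeroʳ n)))

count-unique : ∀ {n} {P : Fin n → Set} (P? : Decidable P) →
  (∀ i j → P i → P j → i ≡ j) → count P? ≤ 1
count-unique {zero}  P? h = z≤n
count-unique {suc n} P? h with P? zero
... | yes p = s≤s (≤-reflexive (count-empty (P? ∘ suc) λ i q → contradiction (h zero (suc i) p q) λ ()))
... | no  _ = count-unique (P? ∘ suc) (λ i j p q → suc-injective (h (suc i) (suc j) p q))

-- Turns a numerical lower bound into distinct vertices; it supplies both sides of a forbidden
-- `ContainsK`.
count⇒injection : ∀ {n} {P : Fin n → Set} (P? : Decidable P) k → k ≤ count P? →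
  Σ (Fin k → Fin n) λ a → Injective _≡_ _≡_ a × (∀ i → P (a i))
count⇒injection P? zero _ = (λ ()) , (λ { {()} }) , λ ()
count⇒injection {suc n} {P} P? (suc k) k<#P with P? zero
... | no _ = let a , a-inj , Pa = count⇒injection (P? ∘ suc) (suc k) k<#P
             in suc ∘ a , a-inj ∘ suc-injective , Pa
... | yes p = a′ , a′-inj , Pa′
  where
  rest = count⇒injection (P? ∘ suc) k (≤-pred k<#P)
  a′ : Fin (suc k) → Fin (suc n)
  a′ zero    = zero
  a′ (suc i) = suc (proj₁ rest i)
  a′-inj : Injective _≡_ _≡_ a′
  a′-inj {zero}  {zero}  _  = refl
  a′-inj {suc i} {suc j} eq = cong suc (proj₁ (proj₂ rest) (suc-injective eq))
  Pa′ : ∀ i → P (a′ i)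
  Pa′ zero    = p
  Pa′ (suc i) = proj₂ (proj₂ rest) i

-- Write `f (a i)` as the sum over `j` of `[a i = j] * f j` and exchange the sums: by injectivity
-- each `j` is hit at most once.
sumFin-injection : ∀ {m n} (f : Fin n → ℕ) (a : Fin m → Fin n) → Injective _≡_ _≡_ a →
  sumFin m (f ∘ a) ≤ sumFin n f
sumFin-injection {m} {n} f a a-inj = begin
  sumFin m (f ∘ a)                                          ≤⟨ sumFin-mono m pick ⟩
  sumFin m (λ i → sumFin n (λ j → ind (a i Fin.≟ j) * f j)) ≡⟨ sumFin-swap m n _ ⟩
  sumFin n (λ j → sumFin m (λ i → ind (a i Fin.≟ j) * f j)) ≤⟨ sumFin-mono n once ⟩
  sumFin n f                                                ∎
  where
  open ≤-Reasoning
  pick : ∀ i → f (a i) ≤ sumFin n (λ j → ind (a i Fin.≟ j) * f j)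
  pick i = begin
    f (a i)                              ≡⟨ *-identityˡ (f (a i)) ⟨
    1 * f (a i)                          ≡⟨ cong (_* f (a i)) (ind-true (a i Fin.≟ a i) refl) ⟨
    ind (a i Fin.≟ a i) * f (a i)        ≤⟨ term≤sumFin n (λ j → ind (a i Fin.≟ j) * f j) (a i) ⟩
    sumFin n (λ j → ind (a i Fin.≟ j) * f j) ∎
  once : ∀ j → sumFin m (λ i → ind (a i Fin.≟ j) * f j) ≤ f j
  once j = begin
    sumFin m (λ i → ind (a i Fin.≟ j) * f j) ≡⟨ sumFin-*ʳ m (λ i → ind (a i Fin.≟ j)) (f j) ⟩
    count (λ i → a i Fin.≟ j) * f j          ≤⟨ *-monoˡ-≤ (f j) (count-unique (λ i → a i Fin.≟ j) λ i i′ p q → a-inj (trans p (sym q))) ⟩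
    1 * f j                                  ≡⟨ *-identityˡ (f j) ⟩
    f j                                      ∎

injection⇒sumFin-≥ : ∀ {m n d} (f : Fin n → ℕ) (a : Fin m → Fin n) → Injective _≡_ _≡_ a →
  (∀ i → d ≤ f (a i)) → m * d ≤ sumFin n f
injection⇒sumFin-≥ {m} {n} {d} f a a-inj h = begin
  m * d              ≡⟨ sumFin-const m d ⟨
  sumFin m (const d) ≤⟨ sumFin-mono m h ⟩
  sumFin m (f ∘ a)   ≤⟨ sumFin-injection f a a-inj ⟩
  sumFin n f         ∎
  where open ≤-Reasoning

-- Union bound: every counted `j` has a witness `i` that contributes at least 1 to the double sum.
count-∃ : ∀ {n m} {P : Fin m → Fin n → Set} (P? : Decidable₂ P) →
  count (λ j → any? (λ i → P? i j)) ≤ sumFin m (λ i → count (P? i))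
count-∃ {n} {m} P? = begin
  count (λ j → any? (λ i → P? i j))                  ≤⟨ sumFin-mono n (λ j → ind-≤ (any? (λ i → P? i j)) (witness j)) ⟩
  sumFin n (λ j → sumFin m (λ i → ind (P? i j)))     ≡⟨ sumFin-swap m n _ ⟨
  sumFin m (λ i → count (P? i))                      ∎
  where
  open ≤-Reasoning
  witness : ∀ j → ∃ (λ i → _) → 1 ≤ sumFin m (λ i → ind (P? i j))
  witness j (i , p) = ≤-trans (≤-reflexive (sym (ind-true (P? i j) p)))
                              (term≤sumFin m (λ i → ind (P? i j)) i)

-- Largest elements and tournaments

minimum : ∀ {n} {P : Fin n → Set} (P? : Decidable P) (h : Fin n → ℚ) →
  (∀ i → ¬ P i) ⊎ ∃[ i ] (P i × ∀ j → P j → h i ℚ.≤ h j)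
minimum {zero}  P? h = inj₁ λ ()
minimum {suc n} P? h with P? zero | minimum (P? ∘ suc) (h ∘ suc)
... | no ¬p | inj₁ none = inj₁ λ { zero → ¬p ; (suc i) → none i }
... | no ¬p | inj₂ (i , q , i-min) =
  inj₂ (suc i , q , λ { zero p → contradiction p ¬p ; (suc j) → i-min j })
... | yes p | inj₁ none =
  inj₂ (zero , p , λ { zero _ → ℚ.≤-refl ; (suc j) q → contradiction q (none j) })
... | yes p | inj₂ (i , q , i-min) with ℚ.≤-total (h zero) (h (suc i))
... | inj₁ 0≤i = inj₂ (zero , p , λ { zero _ → ℚ.≤-refl ; (suc j) r → ℚ.≤-trans 0≤i (i-min j r) })
... | inj₂ i≤0 = inj₂ (suc i , q , λ { zero _ → i≤0 ; (suc j) → i-min j })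

module _ {n} {S : Fin n → Set} (S? : Decidable S) (h : Fin n → ℚ) (t : ℕ) where

  above? : ∀ i → Decidable (λ j → S j × h i ℚ.≤ h j)
  above? i j = S? j ×-dec (h i ℚ.≤? h j)

  -- The count includes `i` itself and all ties, so ties can only make the selected set smaller than
  -- `t`.
  top? : Decidable (λ i → S i × count (above? i) ≤ t)
  top? i = S? i ×-dec (count (above? i) ≤? t)

  -- A smallest counted element has all counted elements above it.
  count-top : count top? ≤ t
  count-top with minimum top? h
  ... | inj₁ none = ≤-trans (≤-reflexive (count-empty top? none)) z≤n
  ... | inj₂ (i , (_ , few) , i-min) =
    ≤-trans (count-mono top? (above? i) λ j p → proj₁ p , i-min j p) few

module _ {n} {S : Fin n → Set} {T : Fin n → Fin n → Set}
         (S? : Decidable S) (T? : Decidable₂ T) where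

  -- Each of the r² ordered pairs from `S` carries an arc in some direction, so r² is at most twice
  -- the number of arcs, that is, at most 2rD. Totality at `i = j` makes every loop an arc, and `D`
  -- counts loops too.
  tournament-bound : (∀ i j → T i j ⊎ T j i) → ∀ D →
    (∀ i → S i → count (λ j → S? j ×-dec T? i j) ≤ D) → count S? ≤ 2 * D
  tournament-bound total D deg = cancel (count S?) square
    where
    open ≤-Reasoning
    arc : Fin n → Fin n → ℕ
    arc i j = ind (S? i) * ind (S? j ×-dec T? i j)
    either : ∀ i j → ind (S? j) * ind (S? i) ≤ arc i j + arc j i
    either i j with S? i | S? j
    ... | no _  | no _  = z≤n
    ... | no _  | yes _ = z≤n
    ... | yes _ | no _  = z≤n
    ... | yes _ | yes _ with T? i j | T? j i | total i j
    ... | yes _ | _     | _        = s≤s z≤n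
    ... | no _  | yes _ | _        = s≤s z≤n
    ... | no ¬p | no _  | inj₁ p   = contradiction p ¬p
    ... | no _  | no ¬q | inj₂ q   = contradiction q ¬q
    arcs : sumFin n (λ i → sumFin n (arc i)) ≤ count S? * D
    arcs = begin
      sumFin n (λ i → sumFin n (arc i))  ≤⟨ sumFin-mono n row ⟩
      sumFin n (λ i → ind (S? i) * D)    ≡⟨ sumFin-*ʳ n (λ i → ind (S? i)) D ⟩
      count S? * D                       ∎
      where
      row : ∀ i → sumFin n (arc i) ≤ ind (S? i) * D
      row i with S? i
      ... | no _  = ≤-trans (sumFin-≤ n (λ _ → z≤n)) (≤-reflexive (*-zeroʳ n))
      ... | yes s = begin
        sumFin n (λ j → 1 * ind (S? j ×-dec T? i j)) ≡⟨ sumFin-cong n (λ j → *-identityˡ _) ⟩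
        count (λ j → S? j ×-dec T? i j)              ≤⟨ deg i s ⟩
        D                                            ≡⟨ *-identityˡ D ⟨
        1 * D                                        ∎
    square : count S? * count S? ≤ count S? * (2 * D)
    square = begin
      count S? * count S?                                       ≡⟨ sumFin-*ʳ n (λ j → ind (S? j)) (count S?) ⟨
      sumFin n (λ j → ind (S? j) * count S?)                    ≡⟨ sumFin-cong n (λ j → trans (*-comm (ind (S? j)) _) (trans (sym (sumFin-*ʳ n (λ i → ind (S? i)) (ind (S? j)))) (sumFin-cong n (λ i → *-comm (ind (S? i)) _)))) ⟩
      sumFin n (λ j → sumFin n (λ i → ind (S? j) * ind (S? i))) ≤⟨ sumFin-mono n (λ j → sumFin-mono n (λ i → either i j)) ⟩
      sumFin n (λ j → sumFin n (λ i → arc i j + arc j i))       ≡⟨ trans (sumFin-cong n (λ j → sumFin-+ n (λ i → arc i j) (arc j))) (sumFin-+ n _ _) ⟩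
      sumFin n (λ j → sumFin n (λ i → arc i j)) + sumFin n (λ j → sumFin n (arc j))
                                                                ≡⟨ cong (_+ sumFin n (λ j → sumFin n (arc j))) (sumFin-swap n n arc) ⟨
      sumFin n (λ i → sumFin n (arc i)) + sumFin n (λ j → sumFin n (arc j))
                                                                ≤⟨ +-mono-≤ arcs arcs ⟩
      count S? * D + count S? * D                               ≡⟨ solve 2 (λ r d → r :* d :+ r :* d := r :* (con 2 :* d)) refl (count S?) D ⟩
      count S? * (2 * D)                                        ∎
      where open +-*-Solver
    cancel : ∀ r → r * r ≤ r * (2 * D) → r ≤ 2 * D
    cancel zero    _ = z≤n
    cancel (suc r) p = *-cancelˡ-≤ (suc r) p

-- The upper bound for Chain³

-- Negating both maps reverses the order and so reduces the case where `V` gets the rays to the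
-- other one.
chain-coordinates : ∀ {n m} {G : BipGraph n m} → IsChain G →
  Σ (Fin n → ℚ) λ f → Σ (Fin m → ℚ) λ g → ∀ u v → (G u v ≡ true) ⇔ (f u ℚ.≤ g v)
chain-coordinates (f , g , inj₁ iff) = f , g , iff
chain-coordinates (f , g , inj₂ iff) = (ℚ.-_ ∘ f) , (ℚ.-_ ∘ g) , λ u v →
  mk⇔ (ℚ.neg-antimono-≤ ∘ Equivalence.to (iff u v))
      (Equivalence.from (iff u v) ∘ neg-cancel-≤ (f u) (g v))
  where
  neg-cancel-≤ : ∀ p q → ℚ.- p ℚ.≤ ℚ.- q → q ℚ.≤ p
  neg-cancel-≤ p q le = subst₂ ℚ._≤_ (⁻¹-involutive ℚ.+-0-group q) (⁻¹-involutive ℚ.+-0-group p) (ℚ.neg-antimono-≤ le)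

-- Pigeonhole: of three comparisons with two possible directions, two agree; `l` is the remaining
-- coordinate.
below-off-one : (a b : Fin 3 → ℚ) →
  ∃[ l ] (∀ i → i ≢ l → a i ℚ.≤ b i) ⊎ ∃[ l ] (∀ i → i ≢ l → b i ℚ.≤ a i)
below-off-one a b
  with ℚ.≤-total (a zero) (b zero) | ℚ.≤-total (a (suc zero)) (b (suc zero))
     | ℚ.≤-total (a (suc (suc zero))) (b (suc (suc zero)))
... | inj₁ p | inj₁ q | _      = inj₁ (suc (suc zero) , λ { zero _ → p ; (suc zero) _ → q ; (suc (suc zero)) ne → contradiction refl ne })
... | inj₂ p | inj₂ q | _      = inj₂ (suc (suc zero) , λ { zero _ → p ; (suc zero) _ → q ; (suc (suc zero)) ne → contradiction refl ne })
... | inj₁ p | inj₂ _ | inj₁ q = inj₁ (suc zero , λ { zero _ → p ; (suc (suc zero)) _ → q ; (suc zero) ne → contradiction refl ne })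
... | inj₂ p | inj₁ _ | inj₂ q = inj₂ (suc zero , λ { zero _ → p ; (suc (suc zero)) _ → q ; (suc zero) ne → contradiction refl ne })
... | inj₂ _ | inj₁ p | inj₁ q = inj₁ (zero , λ { (suc zero) _ → p ; (suc (suc zero)) _ → q ; zero ne → contradiction refl ne })
... | inj₁ _ | inj₂ p | inj₂ q = inj₂ (zero , λ { (suc zero) _ → p ; (suc (suc zero)) _ → q ; zero ne → contradiction refl ne })

module Dominance {n m : ℕ} (G : BipGraph n m)
  (f : Fin 3 → Fin n → ℚ) (g : Fin 3 → Fin m → ℚ)
  (dominance : ∀ u v → (G u v ≡ true) ⇔ (∀ i → f i u ℚ.≤ g i v))
  (t : ℕ) (K-free : ¬ ContainsK (suc t) G) where

  open ≤-Reasoning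

  edge? : ∀ u → Decidable (λ v → G u v ≡ true)
  edge? u v = G u v Bool.≟ true

  higher : Fin 3 → Fin n → Fin m → ℕ
  higher l u v = count (above? (edge? u) (g l) t v)

  -- The strict inequality provides `suc t` neighbours of `u` at or above `v`, exactly one side of
  -- the forbidden subgraph.
  Survives : Fin n → Fin m → Set
  Survives u v = G u v ≡ true × ∀ l → t < higher l u v

  survives? : ∀ u → Decidable (Survives u)
  survives? u v = edge? u v ×-dec all? (λ l → t <? higher l u v)

  BelowOff : Fin 3 → Fin n → Fin n → Set
  BelowOff l u w = ∀ i → i ≢ l → f i w ℚ.≤ f i u

  belowOff? : ∀ l u → Decidable (BelowOff l u)
  belowOff? l u w = all? (λ i → ¬? (i Fin.≟ l) →-dec (f i w ℚ.≤? f i u))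

  few-below : ∀ l u v → Survives u v →
    count (λ w → edge? w v ×-dec belowOff? l u w) ≤ t
  few-below l u v (_ , many) = ≮⇒≥ λ many-below →
    let a , a-inj , a-below = count⇒injection (λ w → edge? w v ×-dec belowOff? l u w) (suc t) many-below
        b , b-inj , b-above = count⇒injection (above? (edge? u) (g l) t v) (suc t) (many l)
    in K-free (a , b , a-inj , b-inj , λ x y →
      Equivalence.from (dominance (a x) (b y)) λ i →
        a≤b (a-below x) (b-above y) i)
    where
    a≤b : ∀ {w v′} → G w v ≡ true × BelowOff l u w → G u v′ ≡ true × g l v ℚ.≤ g l v′ →
          ∀ i → f i w ℚ.≤ g i v′
    -- In coordinate `l` the chain of inequalities runs from `w` through `v` to `v′`; in the other
    -- two it runs through `u`.
    a≤b (wv , w≤u) (uv′ , v≤v′) i with i Fin.≟ l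
    ... | yes refl = ℚ.≤-trans (Equivalence.to (dominance _ v) wv i) v≤v′
    ... | no i≢l   = ℚ.≤-trans (w≤u i i≢l) (Equivalence.to (dominance u _) uv′ i)

  column-bound : ∀ v → count (λ u → survives? u v) ≤ 6 * t
  column-bound v = ≤-trans
    (tournament-bound (λ u → survives? u v) (λ u w → any? (λ l → belowOff? l u w))
      (λ u w → below-off-one (λ i → f i w) (λ i → f i u)) (3 * t) in-degree)
    (≤-reflexive (sym (*-assoc 2 3 t)))
    where
    in-degree : ∀ u → Survives u v →
      count (λ w → survives? w v ×-dec any? (λ l → belowOff? l u w)) ≤ 3 * t
    in-degree u s = begin
      count (λ w → survives? w v ×-dec any? (λ l → belowOff? l u w))
        ≤⟨ count-mono (λ w → survives? w v ×-dec any? (λ l → belowOff? l u w))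
                      (λ w → any? (λ l → edge? w v ×-dec belowOff? l u w))
                      (λ { w ((wv , _) , l , w≤u) → l , wv , w≤u }) ⟩
      count (λ w → any? (λ l → edge? w v ×-dec belowOff? l u w))
        ≤⟨ count-∃ (λ l w → edge? w v ×-dec belowOff? l u w) ⟩
      sumFin 3 (λ l → count (λ w → edge? w v ×-dec belowOff? l u w))
        ≤⟨ sumFin-≤ 3 (λ l → few-below l u v s) ⟩
      3 * t ∎

  discarded? : ∀ u → Decidable (λ v → ∃[ l ] (G u v ≡ true × higher l u v ≤ t))
  discarded? u v = any? (λ l → top? (edge? u) (g l) t v)

  row-bound : ∀ u → count (discarded? u) ≤ 3 * t
  row-bound u = ≤-trans (count-∃ (λ l v → top? (edge? u) (g l) t v))
    (sumFin-≤ 3 (λ l → count-top (edge? u) (g l) t))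

  edge-split : ∀ u v → (if G u v then 1 else 0) ≤ ind (discarded? u v) + ind (survives? u v)
  edge-split u v = ≤-trans (≤-reflexive (ind-≟true (G u v)))
    (ind-⊎ (edge? u v) (discarded? u v) (survives? u v) split)
    where
    split : G u v ≡ true → ∃[ l ] (G u v ≡ true × higher l u v ≤ t) ⊎ Survives u v
    split uv with discarded? u v
    ... | yes low = inj₁ low
    ... | no keep = inj₂ (uv , λ l → ≰⇒> (λ low → keep (l , uv , low)))

  edges-bound : edges G ≤ n * (3 * t) + m * (6 * t)
  edges-bound = begin
    edges G
      ≤⟨ sumFin-mono n (λ u → sumFin-mono m (edge-split u)) ⟩
    sumFin n (λ u → sumFin m (λ v → ind (discarded? u v) + ind (survives? u v)))
      ≡⟨ trans (sumFin-cong n (λ u → sumFin-+ m _ _)) (sumFin-+ n _ _) ⟩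
    sumFin n (λ u → count (discarded? u)) + sumFin n (λ u → count (survives? u))
      -- Discarded edges are counted by rows and surviving ones by columns, hence the exchange of
      -- sums.
      ≤⟨ +-mono-≤ (sumFin-≤ n row-bound)
           (≤-trans (≤-reflexive (sumFin-swap n m (λ u v → ind (survives? u v))))
                    (sumFin-≤ m column-bound)) ⟩
    n * (3 * t) + m * (6 * t) ∎

chain³-upper-bound : (n k : ℕ) → 1 ≤ n → 1 ≤ k → (G : BipGraph n n) →
  IsChainPow 3 G → ¬ ContainsK k G → edges G ≤ 9 * n * (k ∸ 1)
chain³-upper-bound n (suc t) _ _ G (Gs , chains , G⇔) K-free =
  ≤-trans (Dominance.edges-bound G f g dominance t K-free)
    (≤-reflexive (solve 2 (λ n t → n :* (con 3 :* t) :+ n :* (con 6 :* t) := con 9 :* n :* t) refl n t))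
  where
  open +-*-Solver
  f : Fin 3 → Fin n → ℚ
  f i = proj₁ (chain-coordinates (chains i))
  g : Fin 3 → Fin n → ℚ
  g i = proj₁ (proj₂ (chain-coordinates (chains i)))
  iff : ∀ i u v → (Gs i u v ≡ true) ⇔ (f i u ℚ.≤ g i v)
  iff i = proj₂ (proj₂ (chain-coordinates (chains i)))
  dominance : ∀ u v → (G u v ≡ true) ⇔ (∀ i → f i u ℚ.≤ g i v)
  dominance u v = mk⇔ (λ uv i → Equivalence.to (iff i u v) (Equivalence.to (G⇔ u v) uv i))
                      (λ le → Equivalence.from (G⇔ u v) (λ i → Equivalence.from (iff i u v) (le i)))

-- The lower bound for Chain⁴

-- Points and closed boxes in the integer grid. `linear` says that the incidence graph has no
-- K_{2,2}, and `box p` lists `d` distinct boxes through `p`. The strict bound `width` allows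
-- disjoint copies to be placed side by side; `y-injective` lets a row identify its point.
record BoxConfig (P B : Set) (d : ℕ) : Set where
  field
    width : ℕ
    x y : P → ℕ
    left right bottom top : B → ℕ

  _∈_ : P → B → Set
  p ∈ s = (left s ≤ x p × x p ≤ right s) × (bottom s ≤ y p × y p ≤ top s)

  field
    x<width       : ∀ p → x p < width
    right<width   : ∀ s → right s < width
    y-injective   : Injective _≡_ _≡_ y
    linear        : ∀ {p q s t} → p ∈ s → q ∈ s → p ∈ t → q ∈ t → p ≡ q ⊎ s ≡ t
    box           : P → Fin d → B
    box-injective : ∀ p → Injective _≡_ _≡_ (box p)
    ∈-box         : ∀ p i → p ∈ box p i

-- If `e < c`, then `c * w` is at least `suc e * w`, which exceeds `e * w + r`.
leading-≤ : ∀ {c e w} x r → c * w + x ≤ e * w + r → r < w → c ≤ e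
leading-≤ {c} {e} {w} x r le r<w = ≮⇒≥ λ e<c → <-irrefl refl (begin-strict
  e * w + r <⟨ +-monoʳ-< (e * w) r<w ⟩
  e * w + w ≡⟨ +-comm (e * w) w ⟩
  suc e * w ≤⟨ *-monoˡ-≤ w e<c ⟩
  c * w     ≤⟨ m≤m+n (c * w) x ⟩
  c * w + x ≤⟨ le ⟩
  e * w + r ∎)
  where open ≤-Reasoning

leading-< : ∀ {b w x} (c : Fin b) → x < w → toℕ c * w + x < b * w
leading-< {b} {w} {x} c x<w = begin-strict
  toℕ c * w + x <⟨ +-monoʳ-< (toℕ c * w) x<w ⟩
  toℕ c * w + w ≡⟨ +-comm (toℕ c * w) w ⟩
  suc (toℕ c) * w ≤⟨ *-monoˡ-≤ w (toℕ<n c) ⟩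
  b * w ∎
  where open ≤-Reasoning

initial : ∀ c → BoxConfig (Fin c) (Fin 0) 0
initial c = record
  { width = c ; x = toℕ ; y = toℕ ; left = λ () ; right = λ () ; bottom = λ () ; top = λ ()
  ; x<width = toℕ<n ; right<width = λ () ; y-injective = toℕ-injective
  ; linear = λ { {s = ()} } ; box = λ _ () ; box-injective = λ { _ {()} } ; ∈-box = λ _ () }

-- The new digit is the most significant one in `x′` and the least significant one in `y′`: `b`
-- copies stand side by side, and each old row splits into `b` rows, one per copy. The box `inj₂ q`
-- spans all copies and the `b` rows of `q`, so it holds exactly the copies of `q`.
module Extend {P B : Set} {d : ℕ} (b : ℕ) (C : BoxConfig P B d) where
  open BoxConfig C

  P′ = Fin b × P
  B′ = (Fin b × B) ⊎ P

  x′ y′ : P′ → ℕ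
  x′ (c , p) = toℕ c * width + x p
  y′ (c , p) = y p * b + toℕ c

  left′ right′ bottom′ top′ : B′ → ℕ
  left′ (inj₁ (c , s)) = toℕ c * width + left s
  left′ (inj₂ q) = 0
  right′ (inj₁ (c , s)) = toℕ c * width + right s
  right′ (inj₂ q) = b * width
  bottom′ (inj₁ (c , s)) = bottom s * b + toℕ c
  -- The summand 0 is the lowest digit; it gives the bound the form that `leading-≤` expects.
  bottom′ (inj₂ q) = y q * b + 0
  top′ (inj₁ (c , s)) = top s * b + toℕ c
  top′ (inj₂ q) = y q * b + pred b

  _∈′_ : P′ → B′ → Set
  p ∈′ s = (left′ s ≤ x′ p × x′ p ≤ right′ s) × (bottom′ s ≤ y′ p × y′ p ≤ top′ s)

  pred-b<b : Fin b → pred b < b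
  pred-b<b c = ≤-reflexive (suc-pred b ⦃ >-nonZero (≤-trans (s≤s z≤n) (toℕ<n c)) ⦄)

  same-row : ∀ {p q} {c e : Fin b} → y p * b + toℕ c ≤ y q * b + toℕ e →
    y q * b + toℕ e ≤ y p * b + toℕ c → p ≡ q
  same-row {c = c} {e} le ge =
    y-injective (≤-antisym (leading-≤ _ _ le (toℕ<n e)) (leading-≤ _ _ ge (toℕ<n c)))

  y′-injective : Injective _≡_ _≡_ y′
  y′-injective {c , p} {e , q} eq with same-row {p} {q} {c} {e} (≤-reflexive eq) (≤-reflexive (sym eq))
  ... | refl = cong (_, p) (toℕ-injective (+-cancelˡ-≡ (y p * b) _ _ eq))

  -- Distinct copies occupy disjoint vertical strips, so the abscissa fixes the copy; comparing
  -- leading digits of the ordinates then recovers the old vertical bounds.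
  ∈′-copy : ∀ {c p e s} → (c , p) ∈′ inj₁ (e , s) → c ≡ e × p ∈ s
  ∈′-copy {c} {p} {e} {s} ((l , r) , (bo , to))
    with toℕ-injective {i = c} {e} (≤-antisym (leading-≤ _ _ r (right<width s)) (leading-≤ _ _ l (x<width p)))
  ... | refl = refl , (+-cancelˡ-≤ (toℕ c * width) _ _ l , +-cancelˡ-≤ (toℕ c * width) _ _ r)
                    , (leading-≤ _ _ bo (toℕ<n c) , leading-≤ _ _ to (toℕ<n c))

  ∈′-new : ∀ {c p q} → (c , p) ∈′ inj₂ q → p ≡ q
  ∈′-new {c} (_ , (bo , to)) =
    y-injective (≤-antisym (leading-≤ _ _ to (pred-b<b c)) (leading-≤ _ _ bo (toℕ<n c)))

  -- Two old boxes must lie in the same copy, where `linear` applies. An old box fixes the new digit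
  -- and a new box fixes the old point, so together they share at most one point. A new box is
  -- determined by any point in it.
  linear′ : ∀ {p q s t} → p ∈′ s → q ∈′ s → p ∈′ t → q ∈′ t → p ≡ q ⊎ s ≡ t
  linear′ {s = inj₁ _} {inj₁ _} ps qs pt qt with ∈′-copy ps | ∈′-copy qs | ∈′-copy pt | ∈′-copy qt
  ... | refl , ps | refl , qs | refl , pt | _ , qt with linear ps qs pt qt
  ... | inj₁ refl = inj₁ refl
  ... | inj₂ refl = inj₂ refl
  linear′ {s = inj₁ _} {inj₂ _} ps qs pt qt with ∈′-copy ps | ∈′-copy qs | ∈′-new pt | ∈′-new qt
  ... | refl , _ | refl , _ | refl | refl = inj₁ refl
  linear′ {s = inj₂ _} {inj₁ _} ps qs pt qt with ∈′-new ps | ∈′-new qs | ∈′-copy pt | ∈′-copy qt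
  ... | refl | refl | refl , _ | refl , _ = inj₁ refl
  linear′ {s = inj₂ _} {inj₂ _} ps _ pt _ with ∈′-new ps | ∈′-new pt
  ... | refl | refl = inj₂ refl

  box′ : P′ → Fin (suc d) → B′
  box′ (c , p) zero    = inj₂ p
  box′ (c , p) (suc i) = inj₁ (c , box p i)

  box′-injective : ∀ p → Injective _≡_ _≡_ (box′ p)
  box′-injective p {zero}  {zero}  _  = refl
  box′-injective (c , p) {suc i} {suc j} eq = cong suc (box-injective p (cong proj₂ (inj₁-injective eq)))

  ∈′-box′ : ∀ p i → p ∈′ box′ p i
  ∈′-box′ (c , p) zero =
    (z≤n , <⇒≤ (leading-< c (x<width p))) ,
    (+-monoʳ-≤ (y p * b) z≤n , +-monoʳ-≤ (y p * b) (toℕ≤pred[n] c))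
  ∈′-box′ (c , p) (suc i) =
    let (l , r) , (bo , to) = ∈-box p i in
    (+-monoʳ-≤ (toℕ c * width) l , +-monoʳ-≤ (toℕ c * width) r) ,
    (+-monoˡ-≤ (toℕ c) (*-monoˡ-≤ b bo) , +-monoˡ-≤ (toℕ c) (*-monoˡ-≤ b to))

  right′<width′ : ∀ s → right′ s < suc (b * width)
  right′<width′ (inj₁ (c , s)) = m<n⇒m<1+n (leading-< c (right<width s))
  right′<width′ (inj₂ _)       = ≤-refl

  extend : BoxConfig P′ B′ (suc d)
  extend = record
    -- The successor makes room for the right end `b * width` of the new boxes.
    { width = suc (b * width) ; x = x′ ; y = y′
    ; left = left′ ; right = right′ ; bottom = bottom′ ; top = top′
    ; x<width = λ { (c , p) → m<n⇒m<1+n (leading-< c (x<width p)) }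
    ; right<width = right′<width′ ; y-injective = y′-injective ; linear = linear′
    ; box = box′ ; box-injective = box′-injective ; ∈-box = ∈′-box′ }

-- Words, with the numbers of points and boxes

module Words (b c : ℕ) where

  Point Box : ℕ → Set
  Point zero    = Fin c
  Point (suc ℓ) = Fin b × Point ℓ
  Box zero    = Fin 0
  Box (suc ℓ) = (Fin b × Box ℓ) ⊎ Point ℓ

  config : ∀ ℓ → BoxConfig (Point ℓ) (Box ℓ) ℓ
  config zero    = initial c
  config (suc ℓ) = Extend.extend b (config ℓ)

  #points #boxes : ℕ → ℕ
  #points zero    = c
  #points (suc ℓ) = b * #points ℓ
  #boxes zero    = 0
  #boxes (suc ℓ) = b * #boxes ℓ + #points ℓ

  points-finite : ∀ ℓ → Point ℓ ↔ Fin (#points ℓ)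
  points-finite zero    = ↔-refl
  points-finite (suc ℓ) = ↔-trans (↔-refl ×-↔ points-finite ℓ) (↔-sym *↔×)

  boxes-finite : ∀ ℓ → Box ℓ ↔ Fin (#boxes ℓ)
  boxes-finite zero    = ↔-refl
  boxes-finite (suc ℓ) =
    ↔-trans (↔-trans (↔-refl ×-↔ boxes-finite ℓ) (↔-sym *↔×) ⊎-↔ points-finite ℓ) (↔-sym +↔⊎)

  -- Both sides are the number of incidences: `b` points in each box, `ℓ` boxes through each point.
  b*#boxes : ∀ ℓ → b * #boxes ℓ ≡ ℓ * #points ℓ
  b*#boxes zero    = *-zeroʳ b
  b*#boxes (suc ℓ) = trans (cong (λ z → b * (z + #points ℓ)) (b*#boxes ℓ))
    (solve 3 (λ b l p → b :* (l :* p :+ p) := b :* p :+ l :* (b :* p)) refl b ℓ (#points ℓ))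
    where open +-*-Solver

  #boxes≤#points : ∀ ℓ .⦃ _ : NonZero b ⦄ → ℓ ≤ b → #boxes ℓ ≤ #points ℓ
  #boxes≤#points ℓ ℓ≤b = *-cancelˡ-≤ b (begin
    b * #boxes ℓ  ≡⟨ b*#boxes ℓ ⟩
    ℓ * #points ℓ ≤⟨ *-monoˡ-≤ (#points ℓ) ℓ≤b ⟩
    b * #points ℓ ∎)
    where open ≤-Reasoning

  #points-^ : ∀ ℓ → #points ℓ ≡ c * b ^ ℓ
  #points-^ zero    = sym (*-identityʳ c)
  #points-^ (suc ℓ) = trans (cong (b *_) (#points-^ ℓ))
    (solve 3 (λ b c z → b :* (c :* z) := c :* (b :* z)) refl b c (b ^ ℓ))
    where open +-*-Solver

-- Padding to exactly n vertices

record Coding (A : Set) (n : ℕ) : Set where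
  field
    code        : A → Fin n
    decode      : Fin n → Maybe A
    decode-code : ∀ a → decode (code a) ≡ just a
    code-decode : ∀ i {a} → decode i ≡ just a → i ≡ code a

  code-injective : Injective _≡_ _≡_ code
  code-injective {a} {a′} eq =
    just-injective (trans (sym (decode-code a)) (trans (cong decode eq) (decode-code a′)))

-- The first `m` indices carry the elements of `A`; the other `o` are padding and decode to
-- `nothing`.
coding : ∀ {A m n} → A ↔ Fin m → m ≤ n → Coding A n
coding {A} {m} A↔m m≤n with m≤n⇒∃[o]m+o≡n m≤n
... | o , refl = record
  { code = λ a → to a ↑ˡ o
  ; decode = λ i → decode′ (splitAt m i)
  ; decode-code = λ a → trans (cong decode′ (splitAt-↑ˡ m (to a) o)) (cong just (strictlyInverseʳ a))
  ; code-decode = code-decode′ }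
  where
  open Inverse A↔m using (to; from; strictlyInverseˡ; strictlyInverseʳ)
  decode′ : Fin m ⊎ Fin o → Maybe A
  decode′ = [ just ∘ from , const nothing ]
  code-decode′ : ∀ i {a} → decode′ (splitAt m i) ≡ just a → i ≡ to a ↑ˡ o
  code-decode′ i eq with splitAt m i in split
  code-decode′ i refl | inj₁ j =
    trans (sym (splitAt⁻¹-↑ˡ split)) (cong (_↑ˡ o) (sym (strictlyInverseˡ j)))

-- Comparisons of natural numbers as chain graphs

does⇔ : (d : Dec P) → (does d ≡ true) ⇔ P
does⇔ (yes p) = mk⇔ (const p) (const refl)
does⇔ (no ¬p) = mk⇔ (λ ()) (λ p → contradiction p ¬p)

-- With the explicit denominator 1, comparing two such rationals means comparing the integers
-- `a * 1` and `b * 1`.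
toℚ : ℕ → ℚ
toℚ a = mkℚ (ℤ.+ a) 0 (Coprimality.sym (1-coprimeTo a))

toℚ-≤ : ∀ a b → (a ≤ b) ⇔ (toℚ a ℚ.≤ toℚ b)
toℚ-≤ a b = mk⇔
  (λ le → *≤* (subst₂ ℤ._≤_ (sym (ℤ.*-identityʳ (ℤ.+ a))) (sym (ℤ.*-identityʳ (ℤ.+ b))) (ℤ.+≤+ le)))
  (λ { (*≤* le) → ℤ.drop‿+≤+ (subst₂ ℤ._≤_ (ℤ.*-identityʳ (ℤ.+ a)) (ℤ.*-identityʳ (ℤ.+ b)) le) })

does-≤⇔ : ∀ a b → (does (a ≤? b) ≡ true) ⇔ (toℚ a ℚ.≤ toℚ b)
does-≤⇔ a b = mk⇔
  (Equivalence.to (toℚ-≤ a b) ∘ Equivalence.to (does⇔ (a ≤? b)))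
  (Equivalence.from (does⇔ (a ≤? b)) ∘ Equivalence.from (toℚ-≤ a b))

≤-chain : ∀ {n m} (f : Fin n → ℕ) (g : Fin m → ℕ) → IsChain (λ u v → does (f u ≤? g v))
≤-chain f g = toℚ ∘ f , toℚ ∘ g , inj₁ (λ u v → does-≤⇔ (f u) (g v))

≥-chain : ∀ {n m} (f : Fin n → ℕ) (g : Fin m → ℕ) → IsChain (λ u v → does (g v ≤? f u))
≥-chain f g = toℚ ∘ f , toℚ ∘ g , inj₂ (λ u v → does-≤⇔ (g v) (f u))

-- The incidence graph of a box configuration

module Realise {P B : Set} {d m n : ℕ} (C : BoxConfig P B d)
  (P↔m : P ↔ Fin m) (codeP : Coding P n) (codeB : Coding B n) where

  open BoxConfig C
  open Coding

  -- Codes outside the configuration become points with abscissa 0 and empty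
  -- boxes; the genuine abscissae are shifted by one to stay clear of them.
  X Y : Maybe P → ℕ
  X nothing  = 0
  X (just p) = suc (x p)
  Y nothing  = 0
  Y (just p) = y p

  Left Right Bottom Top : Maybe B → ℕ
  Left nothing    = 1
  Left (just s)   = suc (left s)
  Right nothing   = 0
  Right (just s)  = suc (right s)
  Bottom nothing  = 0
  Bottom (just s) = bottom s
  Top nothing     = 0
  Top (just s)    = top s

  _∈?_ : (p : Maybe P) (s : Maybe B) →
    Dec ((Left s ≤ X p × X p ≤ Right s) × (Bottom s ≤ Y p × Y p ≤ Top s))
  p ∈? s = ((Left s ≤? X p) ×-dec (X p ≤? Right s)) ×-dec ((Bottom s ≤? Y p) ×-dec (Y p ≤? Top s))

  G : BipGraph n n
  G u v = does (decode codeP u ∈? decode codeB v)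

  sides : Fin 4 → BipGraph n n
  sides zero                   u v = does (Left (decode codeB v) ≤? X (decode codeP u))
  sides (suc zero)             u v = does (X (decode codeP u) ≤? Right (decode codeB v))
  sides (suc (suc zero))       u v = does (Bottom (decode codeB v) ≤? Y (decode codeP u))
  sides (suc (suc (suc zero))) u v = does (Y (decode codeP u) ≤? Top (decode codeB v))

  -- A box is an intersection of four half-planes, and each of them contributes one chain graph.
  G-chain⁴ : IsChainPow 4 G
  G-chain⁴ = sides , chains , λ u v → mk⇔ (split u v) (join u v)
    where
    chains : ∀ i → IsChain (sides i)
    chains zero                   = ≥-chain (X ∘ decode codeP) (Left ∘ decode codeB)
    chains (suc zero)             = ≤-chain (X ∘ decode codeP) (Right ∘ decode codeB)
    chains (suc (suc zero))       = ≥-chain (Y ∘ decode codeP) (Bottom ∘ decode codeB)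
    chains (suc (suc (suc zero))) = ≤-chain (Y ∘ decode codeP) (Top ∘ decode codeB)
    split : ∀ u v → G u v ≡ true → ∀ i → sides i u v ≡ true
    split u v uv i with Equivalence.to (does⇔ (decode codeP u ∈? decode codeB v)) uv
    split u v uv zero                   | (l , r) , (bo , to) = Equivalence.from (does⇔ (_ ≤? _)) l
    split u v uv (suc zero)             | (l , r) , (bo , to) = Equivalence.from (does⇔ (_ ≤? _)) r
    split u v uv (suc (suc zero))       | (l , r) , (bo , to) = Equivalence.from (does⇔ (_ ≤? _)) bo
    split u v uv (suc (suc (suc zero))) | (l , r) , (bo , to) = Equivalence.from (does⇔ (_ ≤? _)) to
    join : ∀ u v → (∀ i → sides i u v ≡ true) → G u v ≡ true
    join u v h = Equivalence.from (does⇔ (decode codeP u ∈? decode codeB v))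
      ( ( Equivalence.to (does⇔ (_ ≤? _)) (h zero)
        , Equivalence.to (does⇔ (_ ≤? _)) (h (suc zero)))
      , ( Equivalence.to (does⇔ (_ ≤? _)) (h (suc (suc zero)))
        , Equivalence.to (does⇔ (_ ≤? _)) (h (suc (suc (suc zero))))))

  edge⇒∈ : ∀ u v → G u v ≡ true → ∃[ p ] ∃[ s ] (u ≡ code codeP p × v ≡ code codeB s × p ∈ s)
  edge⇒∈ u v uv with decode codeP u in equ | decode codeB v in eqv
                   | Equivalence.to (does⇔ (decode codeP u ∈? decode codeB v)) uv
  -- Padding has no edges: a padded point has abscissa 0 while every `Left` is at least 1, and a
  -- padded box has `Right` equal to 0 while genuine abscissae are positive.
  ... | nothing | nothing | (() , _) , _
  ... | nothing | just s  | (() , _) , _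
  ... | just p  | nothing | (_ , ()) , _
  ... | just p  | just s  | (s≤s l , s≤s r) , h =
    p , s , code-decode codeP u equ , code-decode codeB v eqv , (l , r) , h

  ∈⇒edge : ∀ {p s} → p ∈ s → G (code codeP p) (code codeB s) ≡ true
  ∈⇒edge {p} {s} ((l , r) , h)
    rewrite decode-code codeP p | decode-code codeB s =
      Equivalence.from (does⇔ (just p ∈? just s)) ((s≤s l , s≤s r) , h)

  G-linear : ∀ {u u′ v v′} → G u v ≡ true → G u′ v ≡ true → G u v′ ≡ true → G u′ v′ ≡ true →
    u ≡ u′ ⊎ v ≡ v′
  G-linear {u} {u′} {v} {v′} uv u′v uv′ u′v′
    with edge⇒∈ u v uv | edge⇒∈ u′ v u′v | edge⇒∈ u v′ uv′ | edge⇒∈ u′ v′ u′v′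
  ... | p , s , refl , refl , ps | q , s₁ , refl , eqs , qs
      | p₁ , t , eqp , refl , pt | q₁ , t₁ , eqq , eqt , qt
    with code-injective codeB eqs | code-injective codeP eqp
       | code-injective codeP eqq | code-injective codeB eqt
  ... | refl | refl | refl | refl with linear ps qs pt qt
  ... | inj₁ refl = inj₁ refl
  ... | inj₂ refl = inj₂ refl

  -- Two vertices from each side of a K_{k,k} would form a K_{2,2}, against `G-linear`.
  G-K-free : ∀ {k} → 2 ≤ k → ¬ ContainsK k G
  G-K-free (s≤s (s≤s z≤n)) (a , b , a-inj , b-inj , K)
    with G-linear (K zero zero) (K (suc zero) zero) (K zero (suc zero)) (K (suc zero) (suc zero))
  ... | inj₁ eq = contradiction (a-inj eq) λ ()
  ... | inj₂ eq = contradiction (b-inj eq) λ ()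

  -- The `m` points have distinct codes, and the row of each contains its `d` distinct boxes; the
  -- injection bound is applied once to rows and once within a row.
  G-edges : m * d ≤ edges G
  G-edges = injection⇒sumFin-≥ _ point point-injective λ i →
    ≤-trans (≤-reflexive (sym (*-identityʳ d)))
      (injection⇒sumFin-≥ _ (code codeB ∘ box (from i)) (box-injective (from i) ∘ code-injective codeB)
        (λ j → ≤-reflexive (sym (cong (if_then 1 else 0) (∈⇒edge (∈-box (from i) j))))))
    where
    open Inverse P↔m using (to; from; strictlyInverseˡ)
    point : Fin m → Fin n
    point = code codeP ∘ from
    point-injective : Injective _≡_ _≡_ point
    point-injective {i} {j} eq = trans (sym (strictlyInverseˡ i))
      (trans (cong to (code-injective codeP eq)) (strictlyInverseˡ j))

-- Binary logarithms

n<2^[1+⌊log₂n⌋] : ∀ n → n < 2 ^ suc ⌊log₂ n ⌋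
n<2^[1+⌊log₂n⌋] n = ≰⇒> λ le → <-irrefl refl
  (subst (_≤ ⌊log₂ n ⌋) (⌊log₂[2^n]⌋≡n (suc ⌊log₂ n ⌋)) (⌊log₂⌋-mono-≤ le))

-- Induction by halving: passing from `n` to its half lowers both the exponent and the logarithm by
-- one.
n<2^j⇒⌊log₂n⌋<j : ∀ j n → 1 ≤ n → n < 2 ^ j → ⌊log₂ n ⌋ < j
n<2^j⇒⌊log₂n⌋<j zero    n 1≤n n<1 = contradiction 1≤n (<⇒≱ n<1)
n<2^j⇒⌊log₂n⌋<j (suc j) 1 _ _ = s≤s z≤n
n<2^j⇒⌊log₂n⌋<j (suc j) n@(suc (suc m)) _ n<2^ = s≤s (∸1<⇒≤ (subst (_< j)
  (⌊log₂⌊n/2⌋⌋≡⌊log₂n⌋∸1 n) (n<2^j⇒⌊log₂n⌋<j j ⌊ n /2⌋ (s≤s z≤n) half<)))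
  where
  open ≤-Reasoning
  ∸1<⇒≤ : ∀ {l} → l ∸ 1 < j → l ≤ j
  ∸1<⇒≤ {zero}  _ = z≤n
  ∸1<⇒≤ {suc l} p = p
  half< : ⌊ n /2⌋ < 2 ^ j
  half< = ≰⇒> λ le → <-irrefl refl (begin-strict
    n                             <⟨ n<2^ ⟩
    2 ^ j + (2 ^ j + 0)           ≡⟨ cong (λ z → 2 ^ j + z) (+-identityʳ (2 ^ j)) ⟩
    2 ^ j + 2 ^ j                 ≤⟨ +-mono-≤ le (≤-trans le (⌊n/2⌋≤⌈n/2⌉ n)) ⟩
    ⌊ n /2⌋ + ⌈ n /2⌉             ≡⟨ ⌊n/2⌋+⌈n/2⌉≡n n ⟩
    n                             ∎)

2^⌊log₂n⌋≤n : ∀ n → 1 ≤ n → 2 ^ ⌊log₂ n ⌋ ≤ n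
2^⌊log₂n⌋≤n n 1≤n = ≮⇒≥ λ lt → <-irrefl refl (n<2^j⇒⌊log₂n⌋<j ⌊log₂ n ⌋ n 1≤n lt)

n<2^n : ∀ n → n < 2 ^ n
n<2^n zero    = s≤s z≤n
n<2^n (suc n) = begin-strict
  suc n             <⟨ s<s (n<2^n n) ⟩
  1 + 2 ^ n         ≤⟨ +-monoˡ-≤ (2 ^ n) (m^n>0 2 n) ⟩
  2 ^ n + 2 ^ n     ≡⟨ cong (λ z → 2 ^ n + z) (+-identityʳ (2 ^ n)) ⟨
  2 ^ suc n         ∎
  where open ≤-Reasoning

-- Choice of parameters for the lower bound

chain⁴-lower-bound : (k : ℕ) → 2 ≤ k →
  ∃[ d ] (1 ≤ d × ∃[ N ] ((n : ℕ) → N ≤ n →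
    ∃[ G ] (IsChainPow 4 {n} {n} G × ¬ ContainsK k G ×
      n * k * ⌊log₂ n ⌋ ≤ d * edges G * ⌊log₂ ⌊log₂ n ⌋ ⌋)))
chain⁴-lower-bound k 2≤k =
  -- This is the reciprocal of the constant: 2 from `n < 2 * 2 ^ L`, 4 from `L≤4ℓM`, and `k` because
  -- the graph is already K_{2,2}-free. From 4 on, the iterated logarithm `M` is at least 1.
  8 * k , *-mono-≤ {1} {8} (s≤s z≤n) (≤-trans (s≤s z≤n) 2≤k) , 4 , construction
  where
  construction : (n : ℕ) → 4 ≤ n →
    ∃[ G ] (IsChainPow 4 {n} {n} G × ¬ ContainsK k G ×
      n * k * ⌊log₂ n ⌋ ≤ 8 * k * edges G * ⌊log₂ ⌊log₂ n ⌋ ⌋)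
  construction n 4≤n = G , G-chain⁴ , G-K-free 2≤k , bound
    where
    open ≤-Reasoning
    -- The `L` available bits split into `ℓ` digits of `q` bits and a last symbol of `r` bits, which
    -- gives exactly `2 ^ L` words. With `q = suc M` the base `2 ^ q` exceeds `L`, hence also `ℓ`.
    L M q ℓ r : ℕ
    L = ⌊log₂ n ⌋
    M = ⌊log₂ L ⌋
    q = suc M
    ℓ = L / q
    r = L % q

    2≤L : 2 ≤ L
    2≤L = ⌊log₂⌋-mono-≤ 4≤n

    1≤M : 1 ≤ M
    1≤M = ⌊log₂⌋-mono-≤ 2≤L

    1≤L : 1 ≤ L
    1≤L = ≤-trans (s≤s z≤n) 2≤L

    q≤L : q ≤ L
    q≤L = ≤-trans (n<2^n M) (2^⌊log₂n⌋≤n L 1≤L)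

    1≤ℓ : 1 ≤ ℓ
    1≤ℓ = m≥n⇒m/n>0 q≤L

    open Words (2 ^ q) (2 ^ r)

    instance
      2^q≢0 : NonZero (2 ^ q)
      2^q≢0 = m^n≢0 2 q

    #points≡ : #points ℓ ≡ 2 ^ L
    #points≡ = begin-equality
      #points ℓ              ≡⟨ #points-^ ℓ ⟩
      2 ^ r * (2 ^ q) ^ ℓ    ≡⟨ cong (2 ^ r *_) (^-*-assoc 2 q ℓ) ⟩
      2 ^ r * 2 ^ (q * ℓ)    ≡⟨ ^-distribˡ-+-* 2 r (q * ℓ) ⟨
      2 ^ (r + q * ℓ)        ≡⟨ cong (λ z → 2 ^ (r + z)) (*-comm q ℓ) ⟩
      2 ^ (r + ℓ * q)        ≡⟨ cong (2 ^_) (m≡m%n+[m/n]*n L q) ⟨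
      2 ^ L                  ∎

    #points≤n : #points ℓ ≤ n
    #points≤n = ≤-trans (≤-reflexive #points≡) (2^⌊log₂n⌋≤n n (≤-trans (s≤s z≤n) 4≤n))

    ℓ≤2^q : ℓ ≤ 2 ^ q
    ℓ≤2^q = ≤-trans (m/n≤m L q) (<⇒≤ (n<2^[1+⌊log₂n⌋] L))

    open Realise (config ℓ) (points-finite ℓ) (coding (points-finite ℓ) #points≤n)
      (coding (boxes-finite ℓ) (≤-trans (#boxes≤#points ℓ ℓ≤2^q) #points≤n))

    -- The remainder is below `q`, hence at most `ℓ * q`, so `L` is at most `2 * ℓ * q`; and
    -- `q = 1 + M` is at most `2 * M`.
    L≤4ℓM : L ≤ 4 * (ℓ * M)
    L≤4ℓM = begin
      L                       ≡⟨ m≡m%n+[m/n]*n L q ⟩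
      r + ℓ * q               ≤⟨ +-monoˡ-≤ (ℓ * q) (<⇒≤ (m%n<n L q)) ⟩
      q + ℓ * q               ≤⟨ +-monoˡ-≤ (ℓ * q) (≤-trans (≤-reflexive (sym (*-identityˡ q))) (*-monoˡ-≤ q 1≤ℓ)) ⟩
      ℓ * q + ℓ * q           ≤⟨ +-mono-≤ (*-monoʳ-≤ ℓ (+-monoˡ-≤ M 1≤M)) (*-monoʳ-≤ ℓ (+-monoˡ-≤ M 1≤M)) ⟩
      ℓ * (M + M) + ℓ * (M + M) ≡⟨ solve 2 (λ l m → l :* (m :+ m) :+ l :* (m :+ m) := con 4 :* (l :* m)) refl ℓ M ⟩
      4 * (ℓ * M)             ∎
      where open +-*-Solver

    bound : n * k * L ≤ 8 * k * edges G * M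
    bound = begin
      n * k * L                                ≤⟨ *-mono-≤ (*-monoˡ-≤ k (<⇒≤ (n<2^[1+⌊log₂n⌋] n))) L≤4ℓM ⟩
      2 * 2 ^ L * k * (4 * (ℓ * M))            ≡⟨ solve 4 (λ z k l m → con 2 :* z :* k :* (con 4 :* (l :* m)) := con 8 :* k :* (z :* l) :* m) refl (2 ^ L) k ℓ M ⟩
      8 * k * (2 ^ L * ℓ) * M                  ≡⟨ cong (λ z → 8 * k * (z * ℓ) * M) #points≡ ⟨
      8 * k * (#points ℓ * ℓ) * M              ≤⟨ *-monoˡ-≤ M (*-monoʳ-≤ (8 * k) G-edges) ⟩
      8 * k * edges G * M                      ∎
      where open +-*-Solver

theorem1 : ( (n k : ℕ) → 1 ≤ n → 1 ≤ k → (G : BipGraph n n) →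
    IsChainPow 3 G → ¬ ContainsK k G → edges G ≤ 9 * n * (k ∸ 1) )
    ×
    ( (k : ℕ) → 2 ≤ k →
    ∃[ d ] (1 ≤ d × ∃[ N ] ((n : ℕ) → N ≤ n →
    ∃[ G ] (IsChainPow 4 {n} {n} G × ¬ ContainsK k G ×
    n * k * ⌊log₂ n ⌋ ≤ d * edges G * ⌊log₂ ⌊log₂ n ⌋ ⌋))) )
theorem1 = chain³-upper-bound , chain⁴-lower-bound
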